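{- For every constraint list $C$ and every substitution $\sigma$: if $\mathsf{unify}(C)=\sigma$, then $\mathsf{FTV}(\sigma)\subseteq\mathsf{FTV}(C)$.
   Context: Types: fix a set of type variables (with decidable equality), ranged over by $\alpha,\beta,\dots$. Types are generated by $\tau ::= \alpha \mid \tau_1 \rightarrow \tau_2$. Free variables of a type (a list): $\mathsf{FTV}(\alpha) = [\alpha]$, $\mathsf{FTV}(\tau\rightarrow\tau') = \mathsf{FTV}(\tau) \mathbin{+\!\!+} \mathsf{FTV}(\tau')$, where $+\!\!+$ is list append. "$\alpha$ occurs in $\tau$" means $\alpha\in\mathsf{FTV}(\tau)$. Constraints: a constraint is a formal equation $\tau \stackrel{\rm e}{=} \tau'$ between types; a constraint list is a finite list of constraints. $\mathsf{FTV}([\,])=[\,]$ and $\mathsf{FTV}((\tau_1\stackrel{\rm e}{=}\tau_2)::C)=\mathsf{FTV}(\tau_1)\mathbin{+\!\!+}\mathsf{FTV}(\tau_2)\mathbin{+\!\!+}\mathsf{FTV}(C)$. For lists, $l\subseteq l'$ means every member of $l$ is a member of $l'$. Substitutions: a substitution $\sigma$ is a finite map (finite partial function) from type variables to types. $\sigma_{\mathbb{E}}$ is the empty finite map and $\{\alpha\mapsto\tau\}$ the map whose only binding sends $\alpha$ to $\tau$. Application: $\sigma(\alpha)=\tau$ if $\langle\alpha,\tau\rangle\in\sigma$, $\sigma(\alpha)=\alpha$ if $\alpha$ is not bound by $\sigma$; $\sigma(\tau_1\rightarrow\tau_2)=\sigma(\tau_1)\rightarrow\sigma(\tau_2)$;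 $\sigma(\tau_1\stackrel{\rm e}{=}\tau_2) = (\sigma(\tau_1)\stackrel{\rm e}{=}\sigma(\tau_2))$; and $\sigma(C)$ is obtained by applying $\sigma$ to each constraint in the list $C$. $\mathsf{dom\_subst}(\sigma)$ is the list of variables bound by $\sigma$ (the keys); $\mathsf{range\_subst}(\sigma)$ is the concatenation of the lists $\mathsf{FTV}(\tau)$ over all bindings $\langle\alpha,\tau\rangle\in\sigma$; $\mathsf{FTV}(\sigma)=\mathsf{dom\_subst}(\sigma)\mathbin{+\!\!+}\mathsf{range\_subst}(\sigma)$. Composition: $\sigma\circ\sigma'$ is the finite map that binds $\alpha$ to $\sigma'(\tau)$ if $\langle\alpha,\tau\rangle\in\sigma$; binds $\alpha$ to $\tau'$ if $\alpha$ is not bound by $\sigma$ and $\langle\alpha,\tau'\rangle\in\sigma'$; and leaves $\alpha$ unbound otherwise. Unification: $\mathsf{unify}$ takes a constraint list and either fails ($\mathsf{None}$) or succeeds with a substitution ($\mathsf{Some}\;\sigma$); "$\mathsf{unify}(C)=\sigma$" means that it succeeds with result exactly $\sigma$. It is defined by (with $\tau$ a non-variable type in the third and fourth clauses, and failure of a recursive call propagating): (1) $\mathsf{unify}([\,]) = \sigma_{\mathbb{E}}$; (2) $\mathsf{unify}((\alpha\stackrel{\rm e}{=}\beta)::C) = \mathsf{unify}(C)$ if $\alpha=\beta$, else $\{\alpha\mapsto\beta\}\circ\mathsf{unify}(\{\alpha\mapsto\beta\}(C))$; (3) $\mathsf{unify}((\alpha\stackrel{\rm e}{=}\tau)::C)$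 fails if $\alpha$ occurs in $\tau$, else is $\{\alpha\mapsto\tau\}\circ\mathsf{unify}(\{\alpha\mapsto\tau\}(C))$; (4) $\mathsf{unify}((\tau\stackrel{\rm e}{=}\alpha)::C)$ fails if $\alpha$ occurs in $\tau$, else is $\{\alpha\mapsto\tau\}\circ\mathsf{unify}(\{\alpha\mapsto\tau\}(C))$; (5) $\mathsf{unify}((\tau_1\rightarrow\tau_2\stackrel{\rm e}{=}\tau_3\rightarrow\tau_4)::C) = \mathsf{unify}((\tau_1\stackrel{\rm e}{=}\tau_3)::(\tau_2\stackrel{\rm e}{=}\tau_4)::C)$. This is a total function by well-founded recursion on the lexicographically ordered triple (number of distinct variables in the list, total number of arrows in the list, length of the list). -}

module Defs where

open import Data.List using (List; []; _∷_; _++_; map; filter; length; concatMap; deduplicate)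
open import Data.List.Membership.Propositional using (_∈_; _∉_)
open import Data.List.Membership.Propositional.Properties
  using (∈-++⁺ˡ; ∈-++⁺ʳ; ∈-++⁻; ∈-filter⁺; ∈-filter⁻; ∈-map⁺; ∈-map⁻; ∈-deduplicate⁺; ∈-deduplicate⁻)
import Data.List.Membership.DecPropositional as DecMembership
open import Data.List.Properties using (map-++; map-∘; filter-notAll)
open import Data.List.Relation.Binary.Subset.Propositional using (_⊆_)
open import Data.List.Relation.Unary.All using ([])
open import Data.List.Relation.Unary.All.Properties using (All¬⇒¬Any; ¬Any⇒All¬)
open import Data.List.Relation.Unary.AllPairs using ([]; _∷_)
open import Data.List.Relation.Unary.Any using (here; there)
import Data.List.Relation.Unary.Any as Any
open import Data.List.Relation.Unary.Unique.Propositional using (Unique)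
open import Data.List.Relation.Unary.Unique.Propositional.Properties using (++⁺)
import Data.List.Relation.Unary.Unique.DecPropositional.Properties as DecUnique
open import Data.Maybe using (Maybe; just; nothing; fromMaybe)
import Data.Maybe as Maybe
open import Data.Nat using (ℕ; suc; _+_; _≤_; _<_; z≤n; s≤s)
open import Data.Nat.Induction using (<-wellFounded)
open import Data.Nat.ListAction using (sum)
open import Data.Nat.Properties using (m≤n⇒m<n∨m≡n; ≤-trans; n<1+n; m≤n⇒m≤1+n)
open import Data.Nat.Tactic.RingSolver using (solve-∀)
open import Data.Product using (_×_; _,_; proj₁; proj₂)
open import Data.Product.Relation.Binary.Lex.Strict using (×-Lex; ×-wellFounded)
open import Data.Sum using (_⊎_; inj₁; inj₂; [_,_]′)
open import Function using (_∘_; id)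
open import Induction.WellFounded using (Acc; acc; WellFounded; module Subrelation)
import Relation.Binary.Construct.On as On
open import Relation.Binary using (DecidableEquality)
open import Relation.Binary.PropositionalEquality using (_≡_; _≢_; refl; sym; subst)
open import Relation.Nullary using (¬?; yes; no)

module Unification (Var : Set) (_≟_ : DecidableEquality Var) where

  open DecMembership _≟_ using (_∈?_; _∉?_)

  infixr 7 _⇒_
  infix  6 _≐_
  infixr 9 _∘ₛ_
  infix  4 _≈_ _≺_ _<₂_ _<₃_

  data Ty : Set where
    var : Var → Ty
    _⇒_ : Ty → Ty → Ty

  FTV : Ty → List Var
  FTV (var α) = α ∷ []
  FTV (τ ⇒ τ′) = FTV τ ++ FTV τ′

  record Constraint : Set where
    constructor _≐_
    field
      lhs rhs : Ty

  FTVᶜ : List Constraint → List Var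
  FTVᶜ [] = []
  FTVᶜ ((τ₁ ≐ τ₂) ∷ C) = FTV τ₁ ++ FTV τ₂ ++ FTVᶜ C

  Bindings : Set
  Bindings = List (Var × Ty)

  keys : Bindings → List Var
  keys = map proj₁

  -- Finite maps from variables to types, as association lists without repeated
  -- keys.  The order of the bindings carries no meaning, so equality of
  -- substitutions is _≈_ below rather than _≡_.
  record Subst : Set where
    field
      bindings : Bindings
      unique   : Unique (keys bindings)

  open Subst public

  lookup : Bindings → Var → Maybe Ty
  lookup [] α = nothing
  lookup ((β , τ) ∷ bs) α with α ≟ β
  ... | yes _ = just τ
  ... | no  _ = lookup bs α

  _≈_ : Subst → Subst → Set
  σ ≈ σ′ = ∀ α → lookup (bindings σ) α ≡ lookup (bindings σ′) α

  dom-subst : Subst → List Var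
  dom-subst σ = keys (bindings σ)

  range-subst : Subst → List Var
  range-subst σ = concatMap (FTV ∘ proj₂) (bindings σ)

  FTVˢ : Subst → List Var
  FTVˢ σ = dom-subst σ ++ range-subst σ

  apply : Subst → Ty → Ty
  apply σ (var α) = fromMaybe (var α) (lookup (bindings σ) α)
  apply σ (τ₁ ⇒ τ₂) = apply σ τ₁ ⇒ apply σ τ₂

  applyᶜ : Subst → List Constraint → List Constraint
  applyᶜ σ = map λ (τ₁ ≐ τ₂) → apply σ τ₁ ≐ apply σ τ₂

  ∅ : Subst
  ∅ = record { bindings = [] ; unique = [] }

  [_↦_] : Var → Ty → Subst
  [ α ↦ τ ] = record { bindings = (α , τ) ∷ [] ; unique = [] ∷ [] }

  mapTypes : (Ty → Ty) → Bindings → Bindings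
  mapTypes f = map λ (α , τ) → α , f τ

  remove : List Var → Bindings → Bindings
  remove αs = filter λ (α , _) → α ∉? αs

  keys-mapTypes : ∀ f bs → keys (mapTypes f bs) ≡ keys bs
  keys-mapTypes f bs = sym (map-∘ bs)

  keys-remove⁻ : ∀ αs bs {α} → α ∈ keys (remove αs bs) → α ∈ keys bs × α ∉ αs
  keys-remove⁻ αs bs α∈ with ∈-map⁻ proj₁ α∈
  ... | _ , b∈ , refl with ∈-filter⁻ (λ (α , _) → α ∉? αs) {xs = bs} b∈
  ...   | b∈bs , α∉αs = ∈-map⁺ proj₁ b∈bs , α∉αs

  remove-unique : ∀ αs bs → Unique (keys bs) → Unique (keys (remove αs bs))
  remove-unique αs [] [] = []
  remove-unique αs ((α , τ) ∷ bs) (α∉bs ∷ u) with α ∈? αs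
  ... | yes _ = remove-unique αs bs u
  ... | no  _ = ¬Any⇒All¬ _ (All¬⇒¬Any α∉bs ∘ proj₁ ∘ keys-remove⁻ αs bs) ∷ remove-unique αs bs u

  -- Diagrammatic order: σ acts first, then σ′.
  _∘ₛ_ : Subst → Subst → Subst
  σ ∘ₛ σ′ = record
    { bindings = first ++ second
    ; unique   = subst Unique (sym (map-++ proj₁ first second))
        (++⁺ (subst Unique (sym keys-first) (unique σ))
             (remove-unique (dom-subst σ) (bindings σ′) (unique σ′))
             λ (α∈first , α∈second) →
               proj₂ (keys-remove⁻ (dom-subst σ) (bindings σ′) α∈second)
                     (subst (_ ∈_) keys-first α∈first))
    }
    where
    first second : Bindings
    first  = mapTypes (apply σ′) (bindings σ)
    second = remove (dom-subst σ) (bindings σ′)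

    keys-first : keys first ≡ dom-subst σ
    keys-first = keys-mapTypes (apply σ′) (bindings σ)

  arrows : Ty → ℕ
  arrows (var _)   = 0
  arrows (τ₁ ⇒ τ₂) = suc (arrows τ₁ + arrows τ₂)

  arrowsᶜ : List Constraint → ℕ
  arrowsᶜ = sum ∘ map λ (τ₁ ≐ τ₂) → arrows τ₁ + arrows τ₂

  distinct : List Var → ℕ
  distinct = length ∘ deduplicate _≟_

  measure : List Constraint → ℕ × ℕ × ℕ
  measure C = distinct (FTVᶜ C) , arrowsᶜ C , length C

  _<₂_ : ℕ × ℕ → ℕ × ℕ → Set
  _<₂_ = ×-Lex _≡_ _<_ _<_

  _<₃_ : ℕ × ℕ × ℕ → ℕ × ℕ × ℕ → Set
  _<₃_ = ×-Lex _≡_ _<_ _<₂_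

  -- A record, so that case splits in unify-acc do not abstract inside an unfolded measure.
  record _≺_ (C C′ : List Constraint) : Set where
    constructor smaller
    field
      measure-< : measure C <₃ measure C′

  open _≺_ public

  ≺-wellFounded : WellFounded _≺_
  ≺-wellFounded = Subrelation.wellFounded measure-<
    (On.wellFounded measure (×-wellFounded <-wellFounded (×-wellFounded <-wellFounded <-wellFounded)))

  unique-length : ∀ {xs ys : List Var} → Unique xs → xs ⊆ ys → length xs ≤ length ys
  unique-length [] _ = z≤n
  unique-length {x ∷ xs} {ys} (x∉xs ∷ u) xs⊆ys =
    ≤-trans (s≤s (unique-length u xs⊆))
            (filter-notAll x≢? ys (Any.map (λ x≡y x≢y → x≢y x≡y) (xs⊆ys (here refl))))
    where
    x≢? = λ y → ¬? (x ≟ y)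
    xs⊆ : xs ⊆ filter x≢? ys
    xs⊆ y∈xs = ∈-filter⁺ x≢? (xs⊆ys (there y∈xs)) λ { refl → All¬⇒¬Any x∉xs y∈xs }

  distinct-⊆ : ∀ {xs ys} → xs ⊆ ys → distinct xs ≤ distinct ys
  distinct-⊆ {xs} xs⊆ys =
    unique-length (DecUnique.deduplicate-! _≟_ xs)
      (∈-deduplicate⁺ _≟_ ∘ xs⊆ys ∘ ∈-deduplicate⁻ _≟_ xs)

  distinct-⊂ : ∀ {α xs ys} → α ∉ xs → α ∷ xs ⊆ ys → distinct xs < distinct ys
  distinct-⊂ {α} {xs} α∉xs αxs⊆ys =
    unique-length
      (¬Any⇒All¬ _ (α∉xs ∘ ∈-deduplicate⁻ _≟_ xs) ∷ DecUnique.deduplicate-! _≟_ xs)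
      λ { (here refl) → ∈-deduplicate⁺ _≟_ (αxs⊆ys (here refl))
        ; (there β∈)  → ∈-deduplicate⁺ _≟_ (αxs⊆ys (there (∈-deduplicate⁻ _≟_ xs β∈))) }

  shrink : ∀ {C C′} → FTVᶜ C ⊆ FTVᶜ C′ →
           (arrowsᶜ C , length C) <₂ (arrowsᶜ C′ , length C′) → C ≺ C′
  shrink C⊆C′ lt with m≤n⇒m<n∨m≡n (distinct-⊆ C⊆C′)
  ... | inj₁ d< = smaller (inj₁ d<)
  ... | inj₂ d≡ = smaller (inj₂ (d≡ , lt))

  apply-FTV : ∀ {α τ} τ′ {β} → β ∈ FTV (apply [ α ↦ τ ] τ′) → β ∈ FTV τ ⊎ (β ∈ FTV τ′ × β ≢ α)
  apply-FTV {α} (var γ) β∈ with γ ≟ α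
  apply-FTV (var γ) β∈          | yes _  = inj₁ β∈
  apply-FTV (var γ) (here refl) | no γ≢α = inj₂ (here refl , γ≢α)
  apply-FTV {α} {τ} (τ₁ ⇒ τ₂) β∈ with ∈-++⁻ (FTV (apply [ α ↦ τ ] τ₁)) β∈
  ... | inj₁ β∈₁ = [ inj₁ , (λ (β∈ , β≢α) → inj₂ (∈-++⁺ˡ β∈ , β≢α)) ]′ (apply-FTV τ₁ β∈₁)
  ... | inj₂ β∈₂ = [ inj₁ , (λ (β∈ , β≢α) → inj₂ (∈-++⁺ʳ (FTV τ₁) β∈ , β≢α)) ]′ (apply-FTV τ₂ β∈₂)

  applyᶜ-FTV : ∀ {α τ} C {β} → β ∈ FTVᶜ (applyᶜ [ α ↦ τ ] C) → β ∈ FTV τ ⊎ (β ∈ FTVᶜ C × β ≢ α)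
  applyᶜ-FTV {α} {τ} ((τ₁ ≐ τ₂) ∷ C) β∈ with ∈-++⁻ (FTV (apply [ α ↦ τ ] τ₁)) β∈
  ... | inj₁ β∈₁ = [ inj₁ , (λ (β∈ , β≢α) → inj₂ (∈-++⁺ˡ β∈ , β≢α)) ]′ (apply-FTV τ₁ β∈₁)
  ... | inj₂ β∈₂ with ∈-++⁻ (FTV (apply [ α ↦ τ ] τ₂)) β∈₂
  ...   | inj₁ β∈₃ = [ inj₁ , (λ (β∈ , β≢α) → inj₂ (∈-++⁺ʳ (FTV τ₁) (∈-++⁺ˡ β∈) , β≢α)) ]′ (apply-FTV τ₂ β∈₃)
  ...   | inj₂ β∈₄ = [ inj₁ , (λ (β∈ , β≢α) → inj₂ (∈-++⁺ʳ (FTV τ₁) (∈-++⁺ʳ (FTV τ₂) β∈) , β≢α)) ]′ (applyᶜ-FTV C β∈₄)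

  eliminate : ∀ {α τ} C C′ → α ∉ FTV τ → α ∷ FTV τ ++ FTVᶜ C ⊆ FTVᶜ C′ →
              applyᶜ [ α ↦ τ ] C ≺ C′
  eliminate {α} {τ} C C′ α∉τ ⊆C′ = smaller (inj₁ (distinct-⊂ α∉ λ
    { (here refl) → ⊆C′ (here refl)
    ; (there β∈)  → ⊆C′ (there ([ ∈-++⁺ˡ , ∈-++⁺ʳ (FTV τ) ∘ proj₁ ]′ (applyᶜ-FTV C β∈))) }))
    where
    α∉ : α ∉ FTVᶜ (applyᶜ [ α ↦ τ ] C)
    α∉ α∈ = [ α∉τ , (λ (_ , α≢α) → α≢α refl) ]′ (applyᶜ-FTV C α∈)

  eliminateˡ : ∀ {α τ} C → α ∉ FTV τ →
               applyᶜ [ α ↦ τ ] C ≺ ((var α ≐ τ) ∷ C)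
  eliminateˡ {α} {τ} C α∉τ = eliminate C ((var α ≐ τ) ∷ C) α∉τ id

  ∉-var : ∀ {α β} → α ≢ β → α ∉ FTV (var β)
  ∉-var α≢β (here α≡β) = α≢β α≡β

  eliminateʳ : ∀ {α τ} C → α ∉ FTV τ →
               applyᶜ [ α ↦ τ ] C ≺ ((τ ≐ var α) ∷ C)
  eliminateʳ {α} {τ} C α∉τ = eliminate C ((τ ≐ var α) ∷ C) α∉τ λ
    { (here refl) → ∈-++⁺ʳ (FTV τ) (here refl)
    ; (there β∈)  → [ ∈-++⁺ˡ , ∈-++⁺ʳ (FTV τ) ∘ there ]′ (∈-++⁻ (FTV τ) β∈) }

  drop : ∀ {α} C → C ≺ ((var α ≐ var α) ∷ C)
  drop {α} C = shrink {C} {(var α ≐ var α) ∷ C} (there ∘ there) (inj₂ (refl , n<1+n (length C)))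

  decompose : ∀ τ₁ τ₂ τ₃ τ₄ C →
              ((τ₁ ≐ τ₃) ∷ (τ₂ ≐ τ₄) ∷ C) ≺ ((τ₁ ⇒ τ₂ ≐ τ₃ ⇒ τ₄) ∷ C)
  decompose τ₁ τ₂ τ₃ τ₄ C =
    shrink {(τ₁ ≐ τ₃) ∷ (τ₂ ≐ τ₄) ∷ C} {(τ₁ ⇒ τ₂ ≐ τ₃ ⇒ τ₄) ∷ C} vars⊆
      (inj₁ (subst (small <_) (sums (arrows τ₁) (arrows τ₂) (arrows τ₃) (arrows τ₄) (arrowsᶜ C))
                   (m≤n⇒m≤1+n (n<1+n small))))
    where
    small = arrowsᶜ ((τ₁ ≐ τ₃) ∷ (τ₂ ≐ τ₄) ∷ C)

    sums : ∀ a b c d e → suc (suc ((a + c) + ((b + d) + e))) ≡ suc (a + b) + suc (c + d) + e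
    sums = solve-∀

    vars⊆ : FTVᶜ ((τ₁ ≐ τ₃) ∷ (τ₂ ≐ τ₄) ∷ C) ⊆ FTVᶜ ((τ₁ ⇒ τ₂ ≐ τ₃ ⇒ τ₄) ∷ C)
    vars⊆ α∈ with ∈-++⁻ (FTV τ₁) α∈
    ... | inj₁ α∈₁ = ∈-++⁺ˡ (∈-++⁺ˡ α∈₁)
    ... | inj₂ α∈′ with ∈-++⁻ (FTV τ₃) α∈′
    ...   | inj₁ α∈₃ = ∈-++⁺ʳ (FTV τ₁ ++ FTV τ₂) (∈-++⁺ˡ (∈-++⁺ˡ α∈₃))
    ...   | inj₂ α∈″ with ∈-++⁻ (FTV τ₂) α∈″
    ...     | inj₁ α∈₂ = ∈-++⁺ˡ (∈-++⁺ʳ (FTV τ₁) α∈₂)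
    ...     | inj₂ α∈‴ with ∈-++⁻ (FTV τ₄) α∈‴
    ...       | inj₁ α∈₄ = ∈-++⁺ʳ (FTV τ₁ ++ FTV τ₂) (∈-++⁺ˡ (∈-++⁺ʳ (FTV τ₃) α∈₄))
    ...       | inj₂ α∈C = ∈-++⁺ʳ (FTV τ₁ ++ FTV τ₂) (∈-++⁺ʳ (FTV τ₃ ++ FTV τ₄) α∈C)

  unify-acc : ∀ C → Acc _≺_ C → Maybe Subst
  unify-acc [] _ = just ∅
  unify-acc ((var α ≐ var β) ∷ C) (acc rec) with α ≟ β
  ... | yes refl = unify-acc C (rec (drop C))
  ... | no  α≢β  = Maybe.map ([ α ↦ var β ] ∘ₛ_)
                     (unify-acc (applyᶜ [ α ↦ var β ] C)
                       (rec (eliminateˡ C (∉-var α≢β))))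
  unify-acc ((var α ≐ τ@(_ ⇒ _)) ∷ C) (acc rec) with α ∈? FTV τ
  ... | yes _   = nothing
  ... | no  α∉τ = Maybe.map ([ α ↦ τ ] ∘ₛ_)
                    (unify-acc (applyᶜ [ α ↦ τ ] C) (rec (eliminateˡ C α∉τ)))
  unify-acc ((τ@(_ ⇒ _) ≐ var α) ∷ C) (acc rec) with α ∈? FTV τ
  ... | yes _   = nothing
  ... | no  α∉τ = Maybe.map ([ α ↦ τ ] ∘ₛ_)
                    (unify-acc (applyᶜ [ α ↦ τ ] C) (rec (eliminateʳ C α∉τ)))
  unify-acc ((τ₁ ⇒ τ₂ ≐ τ₃ ⇒ τ₄) ∷ C) (acc rec) =
    unify-acc ((τ₁ ≐ τ₃) ∷ (τ₂ ≐ τ₄) ∷ C) (rec (decompose τ₁ τ₂ τ₃ τ₄ C))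

  unify : List Constraint → Maybe Subst
  unify C = unify-acc C (≺-wellFounded C)

{-# OPTIONS --safe #-}
module Submission where

open import Defs
open import Data.List using (List; []; _∷_; _++_)
open import Data.List.Membership.Propositional using (_∈_; find; lose)
open import Data.List.Membership.Propositional.Properties
  using (∈-++⁺ˡ; ∈-++⁺ʳ; ∈-++⁻; ∈-filter⁻; ∈-map⁺; ∈-map⁻; ∈-concatMap⁺; ∈-concatMap⁻)
open import Data.List.Properties using (++-assoc)
open import Data.List.Relation.Binary.Permutation.Propositional
  using (_↭_; ↭-sym; module PermutationReasoning)
open import Data.List.Relation.Binary.Permutation.Propositional.Properties
  using (∈-resp-↭; shift; shifts; ++⁺ˡ)
open import Data.List.Relation.Binary.Subset.Propositional using (_⊆_)
import Data.List.Relation.Binary.Subset.Propositional.Properties as Subset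
open import Data.List.Relation.Unary.All.Properties using (All¬⇒¬Any)
open import Data.List.Relation.Unary.AllPairs using (_∷_)
open import Data.List.Relation.Unary.Any using (here; there)
open import Data.List.Relation.Unary.Unique.Propositional using (Unique)
open import Data.Maybe using (Maybe; just; nothing)
import Data.Maybe as Maybe
open import Data.Maybe.Relation.Binary.Pointwise using (Pointwise; just)
open import Data.Maybe.Relation.Unary.All using (All; just; nothing)
open import Data.Product using (_,_; proj₁; proj₂)
open import Data.Sum using (inj₁; inj₂; [_,_]′)
open import Function using (_∘_; id)
open import Induction.WellFounded using (Acc; acc)
open import Relation.Binary using (DecidableEquality)
open import Relation.Binary.PropositionalEquality using (_≡_; refl; cong; trans)
open import Relation.Nullary using (yes; no; contradiction)

-- The substitution built by an elimination step mentions only α, the variables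
-- of τ, and the variables of the recursive result, which by induction occur in
-- [ α ↦ τ ] C and hence in τ or C.  Equal substitutions have the same bindings,
-- because keys are unique, so their free variables agree as sets.

module FreeVariables (Var : Set) (_≟_ : DecidableEquality Var) where

  open Unification Var _≟_
  open import Data.List.Membership.DecPropositional _≟_ using (_∈?_; _∉?_)

  ++-⊆ : ∀ {xs ys zs : List Var} → xs ⊆ zs → ys ⊆ zs → xs ++ ys ⊆ zs
  ++-⊆ {xs} xs⊆zs ys⊆zs = [ xs⊆zs , ys⊆zs ]′ ∘ ∈-++⁻ xs

  lookup⇒∈ : ∀ bs {α τ} → lookup bs α ≡ just τ → (α , τ) ∈ bs
  lookup⇒∈ ((β , _) ∷ bs) {α} eq with α ≟ β
  lookup⇒∈ (_ ∷ bs) refl | yes refl = here refl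
  lookup⇒∈ (_ ∷ bs) eq   | no  _    = there (lookup⇒∈ bs eq)

  -- `lookup` stops at the first matching key, so a later binding could be shadowed; uniqueness of
  -- keys rules this out.
  ∈⇒lookup : ∀ {bs α τ} → Unique (keys bs) → (α , τ) ∈ bs → lookup bs α ≡ just τ
  ∈⇒lookup {(β , _) ∷ bs} {α} (β∉bs ∷ u) b∈ with α ≟ β | b∈
  ... | yes _    | here refl = refl
  ... | yes refl | there b∈′ = contradiction (∈-map⁺ proj₁ b∈′) (All¬⇒¬Any β∉bs)
  ... | no  α≢α  | here refl = contradiction refl α≢α
  ... | no  _    | there b∈′ = ∈⇒lookup u b∈′

  ≈⇒bindings-⊆ : ∀ {σ ρ} → σ ≈ ρ → bindings ρ ⊆ bindings σ
  ≈⇒bindings-⊆ {σ} {ρ} σ≈ρ {α , _} b∈ =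
    lookup⇒∈ (bindings σ) (trans (σ≈ρ α) (∈⇒lookup (unique ρ) b∈))

  -- Together with `binding-⊆`, this reduces inclusions of `FTVˢ` to single bindings, so that domain
  -- and range need no separate treatment later.
  FTVˢ-⊆⁺ : ∀ σ {xs} → (∀ {α τ} → (α , τ) ∈ bindings σ → α ∷ FTV τ ⊆ xs) → FTVˢ σ ⊆ xs
  FTVˢ-⊆⁺ σ ⊆xs β∈ with ∈-++⁻ (dom-subst σ) β∈
  ... | inj₁ β∈dom with ∈-map⁻ proj₁ β∈dom
  ...   | _ , b∈ , refl = ⊆xs b∈ (here refl)
  FTVˢ-⊆⁺ σ ⊆xs β∈ | inj₂ β∈range
    with find (∈-concatMap⁻ (FTV ∘ proj₂) {xs = bindings σ} β∈range)
  ... | _ , b∈ , β∈τ = ⊆xs b∈ (there β∈τ)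

  binding-⊆ : ∀ σ {α τ} → (α , τ) ∈ bindings σ → α ∷ FTV τ ⊆ FTVˢ σ
  binding-⊆ σ b∈ (here refl) = ∈-++⁺ˡ (∈-map⁺ proj₁ b∈)
  binding-⊆ σ b∈ (there β∈τ) =
    ∈-++⁺ʳ (dom-subst σ) (∈-concatMap⁺ (FTV ∘ proj₂) (lose b∈ β∈τ))

  FTVˢ-resp-≈ : ∀ {σ ρ} → σ ≈ ρ → FTVˢ ρ ⊆ FTVˢ σ
  FTVˢ-resp-≈ {σ} {ρ} σ≈ρ = FTVˢ-⊆⁺ ρ (binding-⊆ σ ∘ ≈⇒bindings-⊆ {σ} {ρ} σ≈ρ)

  FTV-apply : ∀ σ τ → FTV (apply σ τ) ⊆ FTV τ ++ FTVˢ σ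
  FTV-apply σ (var α) β∈ with lookup (bindings σ) α in eq
  -- The outer `there` skips the replaced `α`, which the coarse bound retains; the inner one skips
  -- the key of the binding.
  ... | just _  = there (binding-⊆ σ (lookup⇒∈ (bindings σ) eq) (there β∈))
  ... | nothing = ∈-++⁺ˡ β∈
  FTV-apply σ (τ₁ ⇒ τ₂) =
    ++-⊆ (Subset.++⁺ˡ (FTVˢ σ) (Subset.xs⊆xs++ys (FTV τ₁) (FTV τ₂)) ∘ FTV-apply σ τ₁)
         (Subset.++⁺ˡ (FTVˢ σ) (Subset.xs⊆ys++xs (FTV τ₂) (FTV τ₁)) ∘ FTV-apply σ τ₂)

  -- A binding of the composite is either one of `ρ`, kept unchanged, or one of `σ` with `ρ` applied
  -- to its type, where `FTV-apply` gives the bound.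
  FTVˢ-∘ : ∀ σ ρ → FTVˢ (σ ∘ₛ ρ) ⊆ FTVˢ σ ++ FTVˢ ρ
  FTVˢ-∘ σ ρ = FTVˢ-⊆⁺ (σ ∘ₛ ρ) binding
    where
    binding : ∀ {α τ} → (α , τ) ∈ bindings (σ ∘ₛ ρ) → α ∷ FTV τ ⊆ FTVˢ σ ++ FTVˢ ρ
    binding b∈ β∈ with ∈-++⁻ (mapTypes (apply ρ) (bindings σ)) b∈
    binding b∈ β∈ | inj₂ b∈ρ =
      ∈-++⁺ʳ (FTVˢ σ)
        (binding-⊆ ρ (proj₁ (∈-filter⁻ ((_∉? dom-subst σ) ∘ proj₁) {xs = bindings ρ} b∈ρ)) β∈)
    binding b∈ β∈ | inj₁ b∈σ with ∈-map⁻ _ b∈σ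
    binding b∈ (here refl) | inj₁ _ | _ , b∈′ , refl = ∈-++⁺ˡ (binding-⊆ σ b∈′ (here refl))
    binding b∈ (there β∈τ) | inj₁ _ | (_ , τ) , b∈′ , refl =
      [ ∈-++⁺ˡ ∘ binding-⊆ σ b∈′ ∘ there , ∈-++⁺ʳ (FTVˢ σ) ]′ (∈-++⁻ (FTV τ) (FTV-apply ρ τ β∈τ))

  FTVˢ-singleton : ∀ α τ → FTVˢ [ α ↦ τ ] ⊆ α ∷ FTV τ
  FTVˢ-singleton α τ = FTVˢ-⊆⁺ [ α ↦ τ ] λ { (here refl) → id }

  infix 4 _⊑_

  -- Failure satisfies the bound vacuously, so the induction can follow `unify-acc` without assuming
  -- success.
  _⊑_ : Maybe Subst → List Var → Set
  m ⊑ xs = All (λ σ → FTVˢ σ ⊆ xs) m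

  ⊑-trans : ∀ {m xs ys} → m ⊑ xs → xs ⊆ ys → m ⊑ ys
  ⊑-trans nothing     _     = nothing
  ⊑-trans (just σ⊆xs) xs⊆ys = just (xs⊆ys ∘ σ⊆xs)

  ⊑-result : ∀ {m σ xs} → Pointwise _≈_ m (just σ) → m ⊑ xs → FTVˢ σ ⊆ xs
  ⊑-result {just ρ} {σ} (just ρ≈σ) (just ρ⊆xs) = ρ⊆xs ∘ FTVˢ-resp-≈ {ρ} {σ} ρ≈σ

  -- The target list is `FTVᶜ ((var α ≐ τ) ∷ C)` by computation. By `applyᶜ-FTV`, the recursive
  -- result contributes only variables of `τ` or `C`.
  ⊑-eliminate : ∀ α τ C {m} → m ⊑ FTVᶜ (applyᶜ [ α ↦ τ ] C) →
                Maybe.map ([ α ↦ τ ] ∘ₛ_) m ⊑ α ∷ FTV τ ++ FTVᶜ C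
  ⊑-eliminate α τ C nothing = nothing
  ⊑-eliminate α τ C {just ρ} (just ρ⊆) =
    just (++-⊆ (∈-++⁺ˡ ∘ FTVˢ-singleton α τ)
               (there ∘ [ ∈-++⁺ˡ , ∈-++⁺ʳ (FTV τ) ∘ proj₁ ]′ ∘ applyᶜ-FTV C ∘ ρ⊆)
          ∘ FTVˢ-∘ [ α ↦ τ ] ρ)

  -- Stated for an arbitrary accessibility proof, so that the induction hypothesis fits each
  -- recursive call of `unify-acc`.
  unify-acc-⊑ : ∀ C (a : Acc _≺_ C) → unify-acc C a ⊑ FTVᶜ C
  unify-acc-⊑ [] _ = just λ ()
  unify-acc-⊑ ((var α ≐ var β) ∷ C) (acc rec) with α ≟ β
  ... | yes refl = ⊑-trans (unify-acc-⊑ C _) (there ∘ there)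
  ... | no  _    = ⊑-eliminate α (var β) C (unify-acc-⊑ (applyᶜ [ α ↦ var β ] C) _)
  unify-acc-⊑ ((var α ≐ τ@(_ ⇒ _)) ∷ C) (acc rec) with α ∈? FTV τ
  ... | yes _ = nothing
  ... | no  _ = ⊑-eliminate α τ C (unify-acc-⊑ (applyᶜ [ α ↦ τ ] C) _)
  unify-acc-⊑ ((τ@(_ ⇒ _) ≐ var α) ∷ C) (acc rec) with α ∈? FTV τ
  ... | yes _ = nothing
  -- With the variable on the right, `α` stands after `FTV τ` in the list and has to be moved there
  -- from the front.
  ... | no  _ = ⊑-trans (⊑-eliminate α τ C (unify-acc-⊑ (applyᶜ [ α ↦ τ ] C) _))
                        (∈-resp-↭ (↭-sym (shift α (FTV τ) (FTVᶜ C))))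
  unify-acc-⊑ ((τ₁ ⇒ τ₂ ≐ τ₃ ⇒ τ₄) ∷ C) (acc rec) =
    ⊑-trans (unify-acc-⊑ ((τ₁ ≐ τ₃) ∷ (τ₂ ≐ τ₄) ∷ C) _)
            (∈-resp-↭ (regroup (FTV τ₁) (FTV τ₃) (FTV τ₂) (FTV τ₄) (FTVᶜ C)))
    where
    -- Decomposition puts the variables of `τ₃` before those of `τ₂`; one block swap restores the
    -- order, and the rest is associativity.
    regroup : ∀ (ts us vs ws xs : List Var) →
              ts ++ us ++ vs ++ ws ++ xs ↭ (ts ++ vs) ++ (us ++ ws) ++ xs
    regroup ts us vs ws xs = begin
      ts ++ us ++ vs ++ ws ++ xs     ↭⟨ ++⁺ˡ ts (shifts us vs) ⟩
      ts ++ vs ++ us ++ ws ++ xs     ≡⟨ ++-assoc ts vs _ ⟨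
      (ts ++ vs) ++ us ++ ws ++ xs   ≡⟨ cong ((ts ++ vs) ++_) (++-assoc us ws xs) ⟨
      (ts ++ vs) ++ (us ++ ws) ++ xs ∎
      where open PermutationReasoning

theorem4 : (Var : Set) (_≟_ : DecidableEquality Var) →
    let open Unification Var _≟_ in
    (C : List Constraint) (σ : Subst) →
    Pointwise _≈_ (unify C) (just σ) → FTVˢ σ ⊆ FTVᶜ C
theorem4 Var _≟_ C σ unify≈σ = ⊑-result unify≈σ (unify-acc-⊑ C (≺-wellFounded C))
  where
  open Unification Var _≟_
  open FreeVariables Var _≟_
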